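{- For any positive integer $n$, we have $\chi_b(KG(m,n))=\Theta(m^n)$ (as $m\to\infty$ with $n$ fixed).
   Context: For a positive integer $m$, $[m]$ denotes the set $\{0,1,\ldots,m-1\}$, and $\binom{[m]}{n}$ denotes the collection of all $n$-element subsets of $[m]$. For $m\geq 2n$, the Kneser graph $KG(m,n)$ is the graph with vertex set $\binom{[m]}{n}$ in which two vertices $A$ and $B$ are adjacent if and only if $A\cap B=\emptyset$. The b-chromatic number $\chi_b(G)$ of a graph $G$ is the largest positive integer $t$ such that there exists a proper vertex coloring of $G$ with $t$ colors (all $t$ color classes nonempty) in which every color class contains at least one vertex that has a neighbor in each of the other color classes. The notation $\chi_b(KG(m,n))=\Theta(m^n)$ means: there exist real constants $c_1,c_2>0$ and an integer $m_0$ (all depending on $n$ only) such that $c_1 m^n\leq \chi_b(KG(m,n))\leq c_2 m^n$ for all integers $m\geq m_0$. -}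

module Defs where

open import Data.Fin using (Fin)
open import Data.Fin.Subset using (Subset; ∣_∣; _∩_; ⊥)
open import Data.Fin.Subset.Properties using (∩-comm; ∩-idem; ∣⊥∣≡0)
open import Data.Integer using (+_)
open import Data.Nat using (ℕ; _≤_; _<_; NonZero; ≢-nonZero⁻¹)
open import Data.Product using (Σ-syntax; ∃-syntax; _×_; _,_; proj₁)
open import Data.Rational as ℚ using (ℚ; 0ℚ)
open import Data.Rational.Literals using (fromℤ)
open import Relation.Binary.Definitions using (Symmetric)
open import Relation.Binary.PropositionalEquality
  using (_≡_; _≢_; sym; trans; cong)
open import Relation.Nullary using (¬_)

record Graph : Set₁ where
  field
    Vertex    : Set
    Adj       : Vertex → Vertex → Set
    symmetric : Symmetric Adj
    loopless  : ∀ v → ¬ Adj v v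

module _ (G : Graph) where
  open Graph G

  IsProperColoring : ∀ {t} → (Vertex → Fin t) → Set
  IsProperColoring c = ∀ u v → Adj u v → c u ≢ c v

  -- v has a neighbor in each color class other than its own.
  IsDominating : ∀ {t} → (Vertex → Fin t) → Vertex → Set
  IsDominating c v = ∀ j → j ≢ c v → ∃[ w ] (Adj v w × c w ≡ j)

  -- The second component also forces every color class to be nonempty.
  IsBColoring : ∀ {t} → (Vertex → Fin t) → Set
  IsBColoring c =
    IsProperColoring c × (∀ i → ∃[ v ] (c v ≡ i × IsDominating c v))

  HasBColoring : ℕ → Set
  HasBColoring t = Σ[ c ∈ (Vertex → Fin t) ] IsBColoring c

  -- "χ_b(G) = t".  At most one t satisfies this, by antisymmetry of ≤.
  IsBChromaticNumber : ℕ → Set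
  IsBChromaticNumber t =
    0 < t × HasBColoring t × (∀ s → HasBColoring s → s ≤ t)

-- Equality of vertices is equality of the underlying subsets, since
-- equality proofs in ℕ are unique.
SubsetOfSize : ℕ → ℕ → Set
SubsetOfSize m n = Σ[ A ∈ Subset m ] ∣ A ∣ ≡ n

-- Defined for every m, although the notation is customarily reserved for
-- m ≥ 2n; n ≥ 1 is what makes the graph loopless.
KG : ∀ m n → .{{NonZero n}} → Graph
KG m n = record
  { Vertex    = SubsetOfSize m n
  ; Adj       = λ A B → proj₁ A ∩ proj₁ B ≡ ⊥
  ; symmetric = λ {A} {B} A∩B≡⊥ → trans (∩-comm (proj₁ B) (proj₁ A)) A∩B≡⊥
  ; loopless  = λ (A , ∣A∣≡n) A∩A≡⊥ →
      ≢-nonZero⁻¹ n (trans (sym ∣A∣≡n)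
        (trans (cong ∣_∣ (trans (sym (∩-idem A)) A∩A≡⊥)) (∣⊥∣≡0 m)))
  }

-- f = Θ(g), for a sequence f given as a relation: F m k means f(m) = k.
-- The constants range over ℚ; by density of ℚ in ℝ this is equivalent to
-- allowing real constants.
Θ : (ℕ → ℕ → Set) → (ℕ → ℕ) → Set
Θ F g =
  Σ[ c₁ ∈ ℚ ] Σ[ c₂ ∈ ℚ ] Σ[ m₀ ∈ ℕ ]
    (0ℚ ℚ.< c₁ × 0ℚ ℚ.< c₂ ×
     (∀ m → m₀ ≤ m →
       ∃[ k ] (F m k ×
               c₁ ℚ.* fromℤ (+ g m) ℚ.≤ fromℤ (+ k) ×
               fromℤ (+ k) ℚ.≤ c₂ ℚ.* fromℤ (+ g m))))

{-# OPTIONS --safe #-}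

-- Upper bound: the classes of a b-coloring are nonempty, so there are at most C(m,n) ≤ m^n.
--
-- Lower bound: take any proper coloring with T vertices of distinct colors that see every
-- color in use. Dissolving, one at a time, the color classes without a vertex of that kind
-- leaves these T vertices as they are and ends in a b-coloring with at least T colors.
-- To find such a coloring, let X = {0,…,k−1} with k proportional to m. The n-subsets A of X
-- get distinct colors. In order that each sees the color of every other B, the class of B
-- also contains {b} ∪ S(B) for all b ∈ B, where S(B), a set of n − 1 elements outside X,
-- encodes the sums of consecutive members of B: for b ∈ B ∖ A this set is disjoint from A.
-- The classes do not overlap, because distinct sets with the same consecutive sums
-- interlace, hence are disjoint. Every other n-set is colored by its maximum.

module Submission where

import Data.Bool.Properties as Bool
open import Data.Empty using (⊥)
open import Data.Fin as Fin using (Fin; toℕ; fromℕ<; punchOut)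
open import Data.Fin.Properties
  using (all?; any?; ¬∀⟶∃¬; ¬Fin0; injective⇒≤; punchOut-cong; punchOut-injective;
         toℕ<n; toℕ-injective; toℕ-fromℕ<; fromℕ<-injective; combine-injective;
         splitAt-join; finToFun-funToFin; funToFin-finToFin)
open import Data.Fin.Subset as Subset using (Subset; inside; outside; ∣_∣; _∩_; ∁)
open import Data.Fin.Subset.Properties using (anySubset?; ∣∁p∣≡n∸∣p∣)
open import Data.Integer as ℤ using () renaming (+_ to pos)
import Data.Integer.Properties as ℤ
open import Data.List using (List; []; _∷_; length; take; applyDownFrom)
open import Data.List.Membership.Propositional using (_∈_; _∉_; lose; find)
open import Data.List.Properties
  using (∷-injectiveˡ; ∷-injectiveʳ; length-take; length-applyDownFrom; ≡-dec)
open import Data.List.Relation.Binary.Disjoint.Propositional using (Disjoint)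
open import Data.List.Relation.Unary.Any as Any using (Any; here; there)
open import Data.List.Relation.Unary.Linked as Linked using (Linked; [-]; _∷_)
open import Data.Nat as ℕ
  using (ℕ; zero; suc; _+_; _*_; _∸_; _≤_; _<_; _>_; z≤n; _^_; _/_; NonZero)
open import Data.Nat.DivMod using (m/n*n≤m; /-monoˡ-≤; m*n/n≡m; m≡m%n+[m/n]*n; m%n<n)
import Data.Nat.Properties as ℕ
open import Data.Nat.Tactic.RingSolver using (solve-∀)
open import Data.Product using (Σ; Σ-syntax; ∃; ∃-syntax; _×_; _,_; proj₁; proj₂)
open import Data.Rational as ℚ using (1ℚ; 1/_)
open import Data.Rational.Literals using (fromℤ)
import Data.Rational.Properties as ℚ
import Data.Rational.Unnormalised as ℚᵘ
import Data.Rational.Unnormalised.Properties as ℚᵘ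
open import Data.Sum as Sum using (_⊎_; inj₁; inj₂)
open import Data.Sum.Properties using (inj₁-injective)
open import Data.Unit using (⊤)
open import Data.Vec using (Vec; []; _∷_; lookup; tabulate)
import Data.Vec.Properties as Vec
open import Function using (_∘_)
open import Function.Definitions using (Injective)
open import Relation.Binary.Definitions using (tri<; tri≈; tri>)
  renaming (Decidable to Decidable₂)
open import Relation.Binary.PropositionalEquality
  using (_≡_; _≢_; refl; sym; trans; cong; cong₂; subst; subst₂; _≗_)
open import Relation.Nullary using (¬_; Dec; yes; no; contradiction)
open import Relation.Nullary.Decidable
  using (map′; decidable-stable; ¬?; _×-dec_; _⊎-dec_; _→-dec_)
open import Relation.Unary using (Decidable)
open import Defs

-- b-colorings of a finite graph

greatest : {P : ℕ → Set} → Decidable P → ∀ N → (∀ s → P s → s ≤ N) →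
           ∀ {t} → P t → ∃[ k ] (P k × t ≤ k × (∀ s → P s → s ≤ k))
greatest P? N bound {t} Pt with P? N
... | yes PN = N , PN , bound t Pt , bound
greatest P? zero bound {t} Pt | no ¬PN with z≤n ← bound t Pt = contradiction Pt ¬PN
greatest {P} P? (suc N) bound Pt | no ¬PN = greatest P? N bound′ Pt
  where
  bound′ : ∀ s → P s → s ≤ N
  bound′ s Ps = ℕ.≤-pred (ℕ.≤∧≢⇒< (bound s Ps) λ { refl → ¬PN Ps })

module BColorings (G : Graph)
  (any?ᵥ : {P : Graph.Vertex G → Set} → Decidable P → Dec (∃ P))
  (adj? : Decidable₂ (Graph.Adj G)) where

  open Graph G

  all?ᵥ : {P : Vertex → Set} → Decidable P → Dec (∀ v → P v)
  all?ᵥ P? = map′ (λ ¬∃¬ v → decidable-stable (P? v) λ ¬Pv → ¬∃¬ (v , ¬Pv))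
                  (λ ∀P (v , ¬Pv) → ¬Pv (∀P v))
                  (¬? (any?ᵥ (¬? ∘ P?)))

  -- Colors that are not used impose no condition on v, in contrast to IsDominating.
  SeesUsedColors : ∀ {s} → (Vertex → Fin s) → Vertex → Set
  SeesUsedColors c v = ∀ w → c w ≢ c v → ∃[ u ] (Adj v u × c u ≡ c w)

  hasNeighborColored? : ∀ {s} (c : Vertex → Fin s) v j → Dec (∃[ u ] (Adj v u × c u ≡ j))
  hasNeighborColored? c v j = any?ᵥ λ u → adj? v u ×-dec c u Fin.≟ j

  seesUsedColors? : ∀ {s} (c : Vertex → Fin s) → Decidable (SeesUsedColors c)
  seesUsedColors? c v =
    all?ᵥ λ w → ¬? (c w Fin.≟ c v) →-dec hasNeighborColored? c v (c w)

  IsBColoring? : ∀ {t} (c : Vertex → Fin t) → Dec (IsBColoring G c)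
  IsBColoring? c =
    (all?ᵥ λ u → all?ᵥ λ v → adj? u v →-dec ¬? (c u Fin.≟ c v)) ×-dec
    (all? λ i → any?ᵥ λ v → (c v Fin.≟ i) ×-dec
      (all? λ j → ¬? (j Fin.≟ c v) →-dec hasNeighborColored? c v j))

  -- Needed because the enumerated coloring that stands for a given one agrees with it only
  -- pointwise.
  IsBColoring-cong : ∀ {t} {c c′ : Vertex → Fin t} → c ≗ c′ →
                     IsBColoring G c → IsBColoring G c′
  IsBColoring-cong c≗c′ (proper , dominated) =
    (λ u v u~v e → proper u v u~v (trans (c≗c′ u) (trans e (sym (c≗c′ v))))) ,
    λ i → let v , cv≡i , dom = dominated i in
      v , trans (sym (c≗c′ v)) cv≡i ,
      λ j j≢ → let w , v~w , cw≡j = dom j (λ e → j≢ (trans e (c≗c′ v))) in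
        w , v~w , trans (sym (c≗c′ w)) cw≡j

  -- Choosing one vertex of each color embeds the colors into the vertices, which `f` numbers.
  bColoring⇒≤ : ∀ {N t} {f : Vertex → Fin N} → Injective _≡_ _≡_ f → HasBColoring G t → t ≤ N
  bColoring⇒≤ {f = f} f-inj (c , _ , dominated) =
    injective⇒≤ {f = λ i → f (proj₁ (dominated i))} λ {i} {j} e →
      trans (sym (proj₁ (proj₂ (dominated i))))
        (trans (cong c (f-inj e)) (proj₁ (proj₂ (dominated j))))

  -- Every coloring factors through the numbering `f`, so it is enough to try the t ^ N functions on
  -- `Fin N`.
  HasBColoring? : ∀ {N} {f : Vertex → Fin N} → Injective _≡_ _≡_ f → Decidable (HasBColoring G)
  HasBColoring? f-inj zero = map′
    -- Without colors, a b-coloring exists exactly when there are no vertices.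
    (λ ¬v → (λ v → contradiction v ¬v) , (λ u → contradiction u ¬v) , λ ())
    (λ (c , _) v → ¬Fin0 (c v))
    (¬? (map′ proj₁ (λ v → v , _) (any?ᵥ {P = λ _ → ⊤} λ _ → yes _)))
  HasBColoring? {N} {f} f-inj t@(suc _) = map′
    (λ (i , b) → Fin.finToFun i ∘ f , b)
    (λ (c , b) → Fin.funToFin (extend c) ,
      IsBColoring-cong (λ v → sym (trans (finToFun-funToFin (extend c) (f v)) (extend-f c v))) b)
    (any? λ (i : Fin (t ^ N)) → IsBColoring? (Fin.finToFun i ∘ f))
    where
    extend : (Vertex → Fin t) → Fin N → Fin t
    extend c x with any?ᵥ (λ v → f v Fin.≟ x)
    ... | yes (v , _) = c v
    -- No vertex has the number `x`, so any color will do; one exists since `t` is a successor.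
    ... | no _ = Fin.zero

    extend-f : ∀ c v → extend c (f v) ≡ c v
    extend-f c v with any?ᵥ (λ u → f u Fin.≟ f v)
    ... | yes (u , e) = cong c (f-inj e)
    ... | no ¬∃ = contradiction (v , refl) ¬∃

  bChromaticNumber : ∀ {N} {f : Vertex → Fin N} → Injective _≡_ _≡_ f →
    ∀ {t} → 0 < t → HasBColoring G t → ∃[ k ] (IsBChromaticNumber G k × t ≤ k × k ≤ N)
  bChromaticNumber {N} f-inj 0<t b =
    let k , bk , t≤k , max = greatest (HasBColoring? f-inj) N (λ _ → bColoring⇒≤ f-inj) b in
    k , (ℕ.<-≤-trans 0<t t≤k , bk , max) , t≤k , bColoring⇒≤ f-inj bk

  -- If no vertex of color i sees all used colors, each of them can move to a used color
  -- that it does not see.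
  record Recoloring {s} (c : Vertex → Fin s) (i : Fin s) (v : Vertex) : Set where
    field
      color    : Fin s
      i≢color  : i ≢ color
      used     : ∃[ w ] (color ≡ c w)
      keeps    : c v ≢ i → color ≡ c v
      fresh    : c v ≡ i → ∀ u → Adj v u → c u ≢ color

  module _ {s} (c : Vertex → Fin s) (i : Fin s)
    (unseen : ¬ (∃[ v ] (c v ≡ i × SeesUsedColors c v))) where

    recolor : ∀ v → Recoloring c i v
    recolor v with c v Fin.≟ i
    ... | no cv≢i = record
      { color = c v ; i≢color = cv≢i ∘ sym ; used = v , refl
      ; keeps = λ _ → refl ; fresh = λ cv≡i → contradiction cv≡i cv≢i }
    ... | yes cv≡i with any?ᵥ (λ w → ¬? (c w Fin.≟ c v) ×-dec ¬? (hasNeighborColored? c v (c w)))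
    ...   | yes (w , cw≢cv , ¬sees) = record
      { color = c w ; i≢color = λ e → cw≢cv (trans (sym e) (sym cv≡i)) ; used = w , refl
      ; keeps = λ cv≢i → contradiction cv≡i cv≢i
      ; fresh = λ _ u v~u cu≡cw → ¬sees (u , v~u , cu≡cw) }
    ...   | no ¬∃ = contradiction (v , cv≡i , λ w cw≢cv →
              decidable-stable (hasNeighborColored? c v (c w)) λ ¬sees → ¬∃ (w , cw≢cv , ¬sees))
              unseen

  -- Induction on the number of available colors. If each color has a vertex that sees all used
  -- colors, then every color is in use and `c` is a b-coloring. Otherwise a color without such a
  -- vertex is dissolved and removed by `punchOut`; no `d p` has that color, so these vertices keep
  -- theirs.
  bColoring-≥ : ∀ s (c : Vertex → Fin s) → IsProperColoring G c →
    ∀ {T} (d : Fin T → Vertex) → Injective _≡_ _≡_ (c ∘ d) → (∀ p → SeesUsedColors c (d p)) →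
    ∃[ t ] (T ≤ t × HasBColoring G t)
  bColoring-≥ s c proper d cd-inj sees
    with all? (λ i → any?ᵥ λ v → (c v Fin.≟ i) ×-dec seesUsedColors? c v)
  ... | yes seen = s , injective⇒≤ cd-inj , c , proper , λ i →
    let v , cv≡i , full = seen i in v , cv≡i , λ j j≢cv →
      let w , cw≡j , _ = seen j
          u , v~u , cu≡cw = full w (λ e → j≢cv (trans (sym cw≡j) e))
      in u , v~u , trans cu≡cw cw≡j
  ... | no ¬seen
    with ¬∀⟶∃¬ s _ (λ i → any?ᵥ λ v → (c v Fin.≟ i) ×-dec seesUsedColors? c v) ¬seen
  bColoring-≥ (suc s) c proper d cd-inj sees | no ¬seen | i , unseen =
    bColoring-≥ s c′ proper′ d cd-inj′ sees′
    where
    module R (v : Vertex) = Recoloring (recolor c i unseen v)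

    c′ : Vertex → Fin s
    c′ v = punchOut (R.i≢color v)

    c′-inj : ∀ u v → c′ u ≡ c′ v → R.color u ≡ R.color v
    c′-inj u v = punchOut-injective (R.i≢color u) (R.i≢color v)

    keeps-d : ∀ p → R.color (d p) ≡ c (d p)
    keeps-d p = R.keeps (d p) λ e → unseen (d p , e , sees p)

    proper′ : IsProperColoring G c′
    proper′ u v u~v c′u≡c′v = by-cases (c u Fin.≟ i) (c v Fin.≟ i)
      where
      e : R.color u ≡ R.color v
      e = c′-inj u v c′u≡c′v

      by-cases : Dec (c u ≡ i) → Dec (c v ≡ i) → ⊥
      -- Two vertices of the dissolved class may move to the same color, since they are not
      -- adjacent.
      by-cases (yes cu≡i) (yes cv≡i) = proper u v u~v (trans cu≡i (sym cv≡i))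
      by-cases (yes cu≡i) (no cv≢i)  = R.fresh u cu≡i v u~v (trans (sym (R.keeps v cv≢i)) (sym e))
      by-cases (no cu≢i)  (yes cv≡i) =
        R.fresh v cv≡i u (symmetric u~v) (trans (sym (R.keeps u cu≢i)) e)
      by-cases (no cu≢i)  (no cv≢i)  =
        proper u v u~v (trans (sym (R.keeps u cu≢i)) (trans e (R.keeps v cv≢i)))

    cd-inj′ : Injective _≡_ _≡_ (c′ ∘ d)
    cd-inj′ {p} {q} e = cd-inj (trans (sym (keeps-d p)) (trans (c′-inj (d p) (d q) e) (keeps-d q)))

    sees′ : ∀ p → SeesUsedColors c′ (d p)
    sees′ p w c′w≢ with R.used w
    -- A color in use after the step was already in use before, at `w₀`. The neighbor of `d p` that
    -- carries it is not of color `i`, hence has not moved.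
    ... | w₀ , e with sees p w₀ (λ e′ → c′w≢ (punchOut-cong i
             (trans e (trans e′ (sym (keeps-d p))))))
    ...   | u , v~u , cu≡ = u , v~u , punchOut-cong i (trans (R.keeps u λ cu≡i →
              R.i≢color w (trans (sym cu≡i) (trans cu≡ (sym e)))) (trans cu≡ (sym e)))

-- Finite sets as strictly decreasing lists

-- With the bound put in front of the list, being bounded and being decreasing become a single
-- condition.
Desc : ℕ → List ℕ → Set
Desc m l = Linked _>_ (m ∷ l)

∈⇒< : ∀ {m l x} → Desc m l → x ∈ l → x < m
∈⇒< (m>x ∷ d) (here refl) = m>x
∈⇒< (m>y ∷ d) (there x∈l) = ℕ.<-trans (∈⇒< d x∈l) m>y

Desc-weaken : ∀ {m m′ l} → m ≤ m′ → Desc m l → Desc m′ l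
Desc-weaken m≤m′ [-]       = [-]
Desc-weaken m≤m′ (m>x ∷ d) = ℕ.<-≤-trans m>x m≤m′ ∷ d

Desc-take : ∀ {m l} j → Desc m l → Desc m (take j l)
Desc-take zero    d         = [-]
Desc-take (suc j) [-]       = [-]
Desc-take (suc j) (m>x ∷ d) = m>x ∷ Desc-take j d

∈-take⁻ : ∀ {l : List ℕ} {x} j → x ∈ take j l → x ∈ l
∈-take⁻ {_ ∷ _} (suc j) (here e)    = here e
∈-take⁻ {_ ∷ _} (suc j) (there x∈l) = there (∈-take⁻ j x∈l)

Desc-applyDownFrom : ∀ {k i} j → k + j ≤ i → Desc i (applyDownFrom (k +_) j)
Desc-applyDownFrom         zero    _     = [-]
Desc-applyDownFrom {k} {i} (suc j) k+j<i =
  subst (_≤ i) (ℕ.+-suc k j) k+j<i ∷ Desc-applyDownFrom j ℕ.≤-refl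

∈-applyDownFrom⇒≤ : ∀ {k x} j → x ∈ applyDownFrom (k +_) j → k ≤ x
∈-applyDownFrom⇒≤ {k} (suc j) (here refl) = ℕ.m≤m+n k j
∈-applyDownFrom⇒≤     (suc j) (there x∈)  = ∈-applyDownFrom⇒≤ j x∈

-- The head of a vector of length suc m stands for m, so that no shift is needed.
elements : ∀ {m} → Subset m → List ℕ
elements []                    = []
elements {suc m} (inside  ∷ p) = m ∷ elements p
elements         (outside ∷ p) = elements p

elements-Desc : ∀ {m} (p : Subset m) → Desc m (elements p)
elements-Desc []            = [-]
elements-Desc (inside  ∷ p) = ℕ.n<1+n _ ∷ elements-Desc p
elements-Desc (outside ∷ p) = Desc-weaken (ℕ.n≤1+n _) (elements-Desc p)

∈-elements⇒< : ∀ {m} (p : Subset m) {x} → x ∈ elements p → x < m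
∈-elements⇒< p = ∈⇒< (elements-Desc p)

m∉elements : ∀ {m} (p : Subset m) → m ∉ elements p
m∉elements p m∈ = ℕ.<-irrefl refl (∈-elements⇒< p m∈)

length-elements : ∀ {m} (p : Subset m) → length (elements p) ≡ ∣ p ∣
length-elements []            = refl
length-elements (inside  ∷ p) = cong suc (length-elements p)
length-elements (outside ∷ p) = length-elements p

elements-injective : ∀ {m} (p q : Subset m) → elements p ≡ elements q → p ≡ q
elements-injective []            []            _ = refl
elements-injective (inside  ∷ p) (inside  ∷ q) e =
  cong (inside ∷_) (elements-injective p q (∷-injectiveʳ e))
elements-injective (outside ∷ p) (outside ∷ q) e =
  cong (outside ∷_) (elements-injective p q e)
elements-injective (inside  ∷ p) (outside ∷ q) e =
  contradiction (subst (_ ∈_) e (here refl)) (m∉elements q)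
elements-injective (outside ∷ p) (inside  ∷ q) e =
  contradiction (subst (_ ∈_) (sym e) (here refl)) (m∉elements p)

elements-surjective : ∀ {m l} → Desc m l → Σ[ p ∈ Subset m ] elements p ≡ l
elements-surjective {zero}  [-] = [] , refl
elements-surjective {suc m} [-] = let p , e = elements-surjective {m} [-] in outside ∷ p , e
elements-surjective {suc m} {x ∷ l} (m>x ∷ d) with x ℕ.≟ m
... | yes refl = let p , e = elements-surjective d in inside ∷ p , cong (m ∷_) e
... | no x≢m =
  let p , e = elements-surjective (ℕ.≤∧≢⇒< (ℕ.≤-pred m>x) x≢m ∷ d) in outside ∷ p , e

∩≡⊥⇒disjoint : ∀ {m} (p q : Subset m) → p ∩ q ≡ Subset.⊥ → Disjoint (elements p) (elements q)
∩≡⊥⇒disjoint []            []            _  (() , _)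
∩≡⊥⇒disjoint (inside  ∷ p) (inside  ∷ q) ()
∩≡⊥⇒disjoint (inside  ∷ p) (outside ∷ q) e (here refl , z∈q) = m∉elements q z∈q
∩≡⊥⇒disjoint (inside  ∷ p) (outside ∷ q) e (there z∈p , z∈q) =
  ∩≡⊥⇒disjoint p q (Vec.∷-injectiveʳ e) (z∈p , z∈q)
∩≡⊥⇒disjoint (outside ∷ p) (inside  ∷ q) e (z∈p , here refl) = m∉elements p z∈p
∩≡⊥⇒disjoint (outside ∷ p) (inside  ∷ q) e (z∈p , there z∈q) =
  ∩≡⊥⇒disjoint p q (Vec.∷-injectiveʳ e) (z∈p , z∈q)
∩≡⊥⇒disjoint (outside ∷ p) (outside ∷ q) e = ∩≡⊥⇒disjoint p q (Vec.∷-injectiveʳ e)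

disjoint⇒∩≡⊥ : ∀ {m} (p q : Subset m) → Disjoint (elements p) (elements q) → p ∩ q ≡ Subset.⊥
disjoint⇒∩≡⊥ []            []            _ = refl
disjoint⇒∩≡⊥ (inside  ∷ p) (inside  ∷ q) p#q = contradiction (here refl , here refl) p#q
disjoint⇒∩≡⊥ (inside  ∷ p) (outside ∷ q) p#q =
  cong (outside ∷_) (disjoint⇒∩≡⊥ p q λ (z∈p , z∈q) → p#q (there z∈p , z∈q))
disjoint⇒∩≡⊥ (outside ∷ p) (inside  ∷ q) p#q =
  cong (outside ∷_) (disjoint⇒∩≡⊥ p q λ (z∈p , z∈q) → p#q (z∈p , there z∈q))
disjoint⇒∩≡⊥ (outside ∷ p) (outside ∷ q) p#q = cong (outside ∷_) (disjoint⇒∩≡⊥ p q p#q)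

-- A set `p` contained in a set `q` that is no larger would equal it. For distinct seeds this
-- supplies the b ∈ B ∖ A.
∃∈∉ : ∀ {m} (p q : Subset m) → ∣ q ∣ ≤ ∣ p ∣ → p ≢ q → ∃[ b ] (b ∈ elements p × b ∉ elements q)
∃∈∉ []            []            _    p≢q = contradiction refl p≢q
∃∈∉ (inside  ∷ p) (inside  ∷ q) q≤p  p≢q
  with b , b∈p , b∉q ← ∃∈∉ p q (ℕ.≤-pred q≤p) (p≢q ∘ cong (inside ∷_)) =
  b , there b∈p , λ { (here refl) → m∉elements p b∈p ; (there b∈q) → b∉q b∈q }
∃∈∉ {suc m} (inside ∷ p) (outside ∷ q) _ _ = m , here refl , m∉elements q
∃∈∉ (outside ∷ p) (inside  ∷ q) q<p  p≢q
  with b , b∈p , b∉q ← ∃∈∉ p q (ℕ.<⇒≤ q<p) (λ p≡q → ℕ.<-irrefl (cong ∣_∣ (sym p≡q)) q<p) =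
  b , b∈p , λ { (here refl) → m∉elements p b∈p ; (there b∈q) → b∉q b∈q }
∃∈∉ (outside ∷ p) (outside ∷ q) q≤p  p≢q = ∃∈∉ p q q≤p (p≢q ∘ cong (outside ∷_))

-- The members are read as digits in base `m`. This overcounts the n-subsets but has the right order
-- of magnitude.
encode : ∀ {m} n l → (∀ {x} → x ∈ l → x < m) → length l ≡ n → Fin (m ^ n)
encode zero    []      _  _   = Fin.zero
encode (suc n) (x ∷ l) <m len =
  Fin.combine (fromℕ< (<m (here refl))) (encode n l (<m ∘ there) (ℕ.suc-injective len))

encode-injective : ∀ {m} n l l′ (<m : ∀ {x} → x ∈ l → x < m) (<m′ : ∀ {x} → x ∈ l′ → x < m)
                   len len′ →
                   encode n l <m len ≡ encode n l′ <m′ len′ → l ≡ l′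
encode-injective zero    []      []       _  _   _   _    _ = refl
encode-injective (suc n) (x ∷ l) (y ∷ l′) <m <m′ len len′ e
  with x≡y , l≡l′ ← combine-injective (fromℕ< (<m (here refl))) _ (fromℕ< (<m′ (here refl))) _ e =
  cong₂ _∷_ (fromℕ<-injective _ _ _ _ x≡y) (encode-injective n l l′ _ _ _ _ l≡l′)

-- Consecutive sums and interlacing

-- {b} ∪ S(l), with S(l) placed at and above o.
link : ℕ → ℕ → List ℕ → List ℕ
link o b []              = []
link o b (x ∷ [])        = b ∷ []
link o b (x ∷ l@(y ∷ _)) = o + (x + y) ∷ link o b l

length-link : ∀ o b l → length (link o b l) ≡ length l
length-link o b []          = refl
length-link o b (x ∷ [])    = refl
length-link o b (x ∷ y ∷ l) = cong suc (length-link o b (y ∷ l))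

-- Consecutive sums of a decreasing list decrease, and `b` lies below all of them because b < o. In
-- the bound, `z` acts as a predecessor of `x`, so that the induction passes from one sum to the
-- next.
link-Desc : ∀ {o b x z} l → b < o → x < z → Desc x l → Desc (o + (z + x)) (link o b (x ∷ l))
link-Desc []      b<o x<z _ = ℕ.<-≤-trans b<o (ℕ.m≤m+n _ _) ∷ [-]
link-Desc {o} {b} {x} {z} (y ∷ l) b<o x<z (y<x ∷ d) =
  ℕ.+-monoʳ-< o (subst (_< z + x) (ℕ.+-comm y x) (ℕ.+-mono-<-≤ (ℕ.<-trans y<x x<z) ℕ.≤-refl))
  ∷ link-Desc l b<o y<x d

b∈link : ∀ {o b} x l → b ∈ link o b (x ∷ l)
b∈link x []      = here refl
b∈link x (y ∷ l) = there (b∈link y l)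

∈-link⁻ : ∀ {o b z} l → z ∈ link o b l → z ≡ b ⊎ o ≤ z
∈-link⁻ (x ∷ [])    (here z≡b)   = inj₁ z≡b
∈-link⁻ (x ∷ y ∷ l) (here refl)  = inj₂ (ℕ.m≤m+n _ _)
∈-link⁻ (x ∷ y ∷ l) (there z∈)   = ∈-link⁻ (y ∷ l) z∈

-- If x < x′ and x + y = x′ + y′, then y′ < y < x < x′: the differences between
-- corresponding members alternate in sign, and the two lists interlace.
link-disjoint : ∀ {o b x x′} l l′ → Desc x l → Desc x′ l′ → x < x′ →
                link o b (x ∷ l) ≡ link o b (x′ ∷ l′) → Disjoint (x′ ∷ l′) (x ∷ l)
link-disjoint []      []       _ _ x<x′ _ (here refl , here refl) = ℕ.<-irrefl refl x<x′
-- The lengths differ, and `b` would have to be in the empty tail of the shorter link.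
link-disjoint {o} {b} []      (y ∷ l′) _ _ _ e
  with () ← subst (b ∈_) (sym (∷-injectiveʳ e)) (b∈link y l′)
link-disjoint {o} {b} (y ∷ l) []       _ _ _ e
  with () ← subst (b ∈_) (∷-injectiveʳ e) (b∈link y l)
link-disjoint {o} {b} {x} {x′} (y ∷ l) (y′ ∷ l′) (y<x ∷ d) (y′<x′ ∷ d′) x<x′ e =
  λ { (here refl , z∈)        → ℕ.<⇒≱ x<x′ (∈⇒≤ z∈)
    ; (there z∈ , here refl)  → ℕ.<-asym y<x (ℕ.≤-<-trans (x≤y′ z∈) y′<y)
    ; (there z∈ , there z∈′) → link-disjoint l′ l d′ d y′<y (sym (∷-injectiveʳ e)) (z∈′ , z∈) }
  where
  ∈⇒≤ : ∀ {z} → z ∈ x ∷ y ∷ l → z ≤ x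
  ∈⇒≤ z∈ = ℕ.≤-pred (∈⇒< (ℕ.n<1+n x ∷ y<x ∷ d) z∈)

  x≤y′ : ∀ {z} → z ∈ y′ ∷ l′ → z ≤ y′
  x≤y′ z∈ = ℕ.≤-pred (∈⇒< (ℕ.n<1+n y′ ∷ d′) z∈)

  y′<y : y′ < y
  y′<y = ℕ.≰⇒> λ y≤y′ → ℕ.<⇒≢ (ℕ.+-mono-<-≤ x<x′ y≤y′) (ℕ.+-cancelˡ-≡ o _ _ (∷-injectiveˡ e))

link-tail : ∀ {o b x} l l′ → link o b (x ∷ l) ≡ link o b (x ∷ l′) → l ≡ l′
link-tail []      []       _ = refl
link-tail {b = b} []      (y ∷ l′) e with () ← subst (b ∈_) (sym (∷-injectiveʳ e)) (b∈link y l′)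
link-tail {b = b} (y ∷ l) []       e with () ← subst (b ∈_) (∷-injectiveʳ e) (b∈link y l)
link-tail {o} {b} {x} (y ∷ l) (y′ ∷ l′) e
  with refl ← ℕ.+-cancelˡ-≡ x _ _ (ℕ.+-cancelˡ-≡ o _ _ (∷-injectiveˡ e)) =
  cong (y ∷_) (link-tail l l′ (∷-injectiveʳ e))

-- Different first members would make the lists disjoint, against the common member `z`. Once the
-- first members agree, each sum determines the next member.
link-injective : ∀ {o b z k l l′} → Desc k l → Desc k l′ → z ∈ l → z ∈ l′ →
                 link o b l ≡ link o b l′ → l ≡ l′
link-injective {l = x ∷ l} {x′ ∷ l′} (_ ∷ d) (_ ∷ d′) z∈ z∈′ e with ℕ.<-cmp x x′
... | tri< x<x′ _ _  = contradiction (z∈′ , z∈) (link-disjoint l l′ d d′ x<x′ e)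
... | tri≈ _ refl _  = cong (x ∷_) (link-tail l l′ e)
... | tri> _ _ x′<x  = contradiction (z∈ , z∈′) (link-disjoint l′ l d′ d x′<x (sym e))

-- Vertices of the Kneser graph and their numbering

∣_∣ᵉ : ∀ {m n} → SubsetOfSize m n → List ℕ
∣ p , _ ∣ᵉ = elements p

length-∣∣ᵉ : ∀ {m n} (v : SubsetOfSize m n) → length ∣ v ∣ᵉ ≡ n
length-∣∣ᵉ (p , ∣p∣≡n) = trans (length-elements p) ∣p∣≡n

∣∣ᵉ-injective : ∀ {m n} (u v : SubsetOfSize m n) → ∣ u ∣ᵉ ≡ ∣ v ∣ᵉ → u ≡ v
∣∣ᵉ-injective (p , ∣p∣≡n) (q , ∣q∣≡n) e with refl ← elements-injective p q e =
  cong (p ,_) (ℕ.≡-irrelevant _ _)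

fromList : ∀ {m n l} → Desc m l → length l ≡ n → Σ[ v ∈ SubsetOfSize m n ] ∣ v ∣ᵉ ≡ l
fromList d len with p , refl ← elements-surjective d =
  (p , trans (sym (length-elements p)) len) , refl

index : ∀ {m n} → SubsetOfSize m n → Fin (m ^ n)
index {n = n} v@(p , _) = encode n ∣ v ∣ᵉ (∈-elements⇒< p) (length-∣∣ᵉ v)

index-injective : ∀ {m n} → Injective _≡_ _≡_ (index {m} {n})
index-injective {n = n} {x = u} {v} e =
  ∣∣ᵉ-injective u v (encode-injective n ∣ u ∣ᵉ ∣ v ∣ᵉ _ _ _ _ e)

anySubsetOfSize? : ∀ {m n} {P : SubsetOfSize m n → Set} → Decidable P → Dec (∃ P)
anySubsetOfSize? {m} {n} {P} P? = map′
  (λ (p , e , Pp) → (p , e) , Pp) (λ ((p , e) , Pp) → p , e , Pp)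
  (anySubset? withSize?)
  where
  withSize? : ∀ p → Dec (Σ[ e ∈ ∣ p ∣ ≡ n ] P (p , e))
  withSize? p with ∣ p ∣ ℕ.≟ n
  ... | no ∣p∣≢n = no (∣p∣≢n ∘ proj₁)
  ... | yes e = map′ (e ,_)
    (λ (e′ , Pp) → subst (λ e → P (p , e)) (ℕ.≡-irrelevant e′ e) Pp) (P? (p , e))

elements-∁-disjoint : ∀ {m} (p : Subset m) → Disjoint (elements p) (elements (∁ p))
elements-∁-disjoint []            (() , _)
elements-∁-disjoint (inside  ∷ p) (here refl , z∈)  = m∉elements (∁ p) z∈
elements-∁-disjoint (inside  ∷ p) (there z∈p , z∈)  = elements-∁-disjoint p (z∈p , z∈)
elements-∁-disjoint (outside ∷ p) (z∈p , here refl) = m∉elements p z∈p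
elements-∁-disjoint (outside ∷ p) (z∈p , there z∈)  = elements-∁-disjoint p (z∈p , z∈)

-- The coloring for sets of n + 1 elements

module Construction (n k : ℕ) where

  -- X = [0,k) and S(B) ⊆ [o,∞); elements of the gap [k,o) occur in no class of a seed.
  o : ℕ
  o = k + suc n

  Seed : Set
  Seed = SubsetOfSize k (suc n)

  InClass : List ℕ → List ℕ → Set
  InClass l B = l ≡ B ⊎ Any (λ b → l ≡ link o b B) B

  InClass? : ∀ l B → Dec (InClass l B)
  InClass? l B = ≡-dec ℕ._≟_ l B ⊎-dec Any.any? (λ b → ≡-dec ℕ._≟_ l (link o b B)) B

  k≤o : k ≤ o
  k≤o = ℕ.m≤m+n k (suc n)

  -- The link of a seed with two or more members contains a sum at or above `o`, so it is not inside
  -- [0,k). For a one-element seed the link is the seed itself.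
  link≡seed : ∀ {l B b} → Desc k l → Desc k B → b ∈ B → l ≡ link o b B → l ≡ B
  link≡seed {B = _ ∷ []}    d _ (here refl) e    = e
  link≡seed {B = x ∷ y ∷ B} d _ _           refl =
    contradiction (∈⇒< d (here refl)) (ℕ.≤⇒≯ (ℕ.≤-trans k≤o (ℕ.m≤m+n o _)))

  -- The only member of a link below `k` is its `b`. Equal links therefore have the same `b`, which
  -- lies in both seeds, and `link-injective` applies.
  class-unique : ∀ {l B B′} → Desc k B → Desc k B′ → InClass l B → InClass l B′ → B ≡ B′
  class-unique d d′ (inj₁ refl) (inj₁ refl) = refl
  class-unique d d′ (inj₁ refl) (inj₂ any) with b , b∈B′ , e ← find any = link≡seed d d′ b∈B′ e
  class-unique d d′ (inj₂ any) (inj₁ refl) with b , b∈B , e ← find any = sym (link≡seed d′ d b∈B e)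
  class-unique {B = x ∷ B} d d′ (inj₂ any) (inj₂ any′)
    with b , b∈B , refl ← find any | b′ , b′∈B′ , e ← find any′
    with ∈-link⁻ _ (subst (b ∈_) e (b∈link x B))
  ... | inj₁ refl = link-injective d d′ b∈B b′∈B′ e
  ... | inj₂ o≤b  = contradiction (ℕ.≤-trans k≤o o≤b) (ℕ.<⇒≱ (∈⇒< d b∈B))

  -- A seed meets each of its links in `b`. Two links of one seed share the first sum, or coincide
  -- if the seed has one member.
  class-intersecting : ∀ {l l′ B} → 0 < length B → InClass l B → InClass l′ B → ¬ Disjoint l l′
  class-intersecting {B = x ∷ B} _ (inj₁ refl) (inj₁ refl) l#l′ = l#l′ (here refl , here refl)
  class-intersecting {B = x ∷ B} _ (inj₁ refl) (inj₂ any) l#l′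
    with b , b∈ , refl ← find any = l#l′ (b∈ , b∈link x B)
  class-intersecting {B = x ∷ B} _ (inj₂ any) (inj₁ refl) l#l′
    with b , b∈ , refl ← find any = l#l′ (b∈link x B , b∈)
  class-intersecting {B = x ∷ []} _ (inj₂ (here refl)) (inj₂ (here refl)) l#l′ =
    l#l′ (here refl , here refl)
  class-intersecting {B = x ∷ y ∷ B} _ (inj₂ any) (inj₂ any′) l#l′
    with b , b∈ , refl ← find any | b′ , b′∈ , refl ← find any′ = l#l′ (here refl , here refl)

  class-range : ∀ {l B z} → Desc k B → InClass l B → z ∈ l → z < k ⊎ o ≤ z
  class-range d (inj₁ refl) z∈ = inj₁ (∈⇒< d z∈)
  class-range {B = B} d (inj₂ any) z∈ with b , b∈B , refl ← find any with ∈-link⁻ B z∈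
  ... | inj₁ refl = inj₁ (∈⇒< d b∈B)
  ... | inj₂ o≤z  = inj₂ o≤z

  class-meets-ground : ∀ {l B} → 0 < length B → Desc k B → InClass l B → ∃[ z ] (z ∈ l × z < k)
  class-meets-ground {B = x ∷ B} _ d (inj₁ refl) = x , here refl , ∈⇒< d (here refl)
  class-meets-ground {B = x ∷ B} _ d (inj₂ any) with b , b∈ , refl ← find any =
    b , b∈link x B , ∈⇒< d b∈

  -- The first bound leaves at least `n` elements of [0,k) outside each seed; the second makes room
  -- for the shifted sums, all of which are below o + 2k.
  module _ (m : ℕ) (2n<k : n + suc n ≤ k) (o+2k≤m : o + (k + k) ≤ m) where

    k≤m : k ≤ m
    k≤m = ℕ.≤-trans k≤o (ℕ.≤-trans (ℕ.m≤m+n o _) o+2k≤m)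

    InSomeClass : List ℕ → Set
    InSomeClass l = ∃[ B ] InClass l (∣_∣ᵉ {k} {suc n} B)

    inSomeClass? : ∀ l → Dec (InSomeClass l)
    inSomeClass? l = anySubsetOfSize? λ B → InClass? l ∣ B ∣ᵉ

    Vertex : Set
    Vertex = SubsetOfSize m (suc n)

    Color : Set
    Color = Fin (k ^ suc n) ⊎ Fin m

    -- A relation, so that the color of a vertex can be derived from any description of it, without
    -- evaluating the search in `coloring`.
    data HasColor (v : Vertex) (x : Color) : Set where
      class : (B : Seed) → InClass ∣ v ∣ᵉ ∣ B ∣ᵉ → x ≡ inj₁ (index B) → HasColor v x
      top   : ∀ i l → ∣ v ∣ᵉ ≡ toℕ i ∷ l → ¬ InSomeClass ∣ v ∣ᵉ → x ≡ inj₂ i → HasColor v x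

    coloring : ∀ v → ∃ (HasColor v)
    coloring v with inSomeClass? ∣ v ∣ᵉ
    ... | yes (B , v∈B) = inj₁ (index B) , class B v∈B refl
    ... | no v∉ with ∣ v ∣ᵉ in e | length-∣∣ᵉ v | elements-Desc (proj₁ v)
    ...   | c ∷ l | _ | c<m ∷ _ = inj₂ (fromℕ< c<m) ,
      top (fromℕ< c<m) l (trans e (cong (_∷ l) (sym (toℕ-fromℕ< c<m))))
          (subst (λ l → ¬ InSomeClass l) (sym e) v∉) refl

    seed-Desc : (B : Seed) → Desc k ∣ B ∣ᵉ
    seed-Desc (p , _) = elements-Desc p

    seed-nonempty : (B : Seed) → 0 < length ∣ B ∣ᵉ
    seed-nonempty B = subst (0 <_) (sym (length-∣∣ᵉ B)) ℕ.z<s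

    HasColor-unique : ∀ {v x y} → HasColor v x → HasColor v y → x ≡ y
    HasColor-unique (class B v∈B refl) (class B′ v∈B′ refl) =
      cong (inj₁ ∘ index)
        (∣∣ᵉ-injective B B′ (class-unique (seed-Desc B) (seed-Desc B′) v∈B v∈B′))
    HasColor-unique (class B v∈B _) (top _ _ _ v∉ _) = contradiction (B , v∈B) v∉
    HasColor-unique (top _ _ _ v∉ _) (class B v∈B _) = contradiction (B , v∈B) v∉
    HasColor-unique (top i l e _ refl) (top j l′ e′ _ refl) =
      cong inj₂ (toℕ-injective (∷-injectiveˡ (trans (sym e) e′)))

    HasColor-intersecting : ∀ {u v x} → HasColor u x → HasColor v x → ¬ Disjoint ∣ u ∣ᵉ ∣ v ∣ᵉ
    HasColor-intersecting (class B u∈B refl) (class B′ v∈B′ e)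
      with refl ← index-injective {x = B} {B′} (inj₁-injective e)
      = class-intersecting (seed-nonempty B) u∈B v∈B′
    HasColor-intersecting (class _ _ refl) (top _ _ _ _ ())
    HasColor-intersecting (top _ _ _ _ refl) (class _ _ ())
    HasColor-intersecting {u} {v} (top i l e _ refl) (top j l′ e′ _ refl) u#v =
      u#v (subst (toℕ i ∈_) (sym e) (here refl) , subst (toℕ i ∈_) (sym e′) (here refl))

    code : Color → Fin (k ^ suc n + m)
    code = Fin.join (k ^ suc n) m

    code-injective : Injective _≡_ _≡_ code
    code-injective {x = x} {y} e =
      trans (sym (splitAt-join _ m x)) (trans (cong (Fin.splitAt _) e) (splitAt-join _ m y))

    color : Vertex → Fin (k ^ suc n + m)
    color v = code (proj₁ (coloring v))

    color-proper : IsProperColoring (KG m (suc n)) color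
    color-proper u v u~v e =
      HasColor-intersecting (proj₂ (coloring u))
        (subst (HasColor v) (sym (code-injective e)) (proj₂ (coloring v)))
        (∩≡⊥⇒disjoint (proj₁ u) (proj₁ v) u~v)

    HasColor⇒color≡ : ∀ {v x} → HasColor v x → color v ≡ code x
    HasColor⇒color≡ h = cong code (HasColor-unique (proj₂ (coloring _)) h)

    seedVertex : (A : Seed) → Σ[ v ∈ Vertex ] ∣ v ∣ᵉ ≡ ∣ A ∣ᵉ
    seedVertex A = fromList (Desc-weaken k≤m (seed-Desc A)) (length-∣∣ᵉ A)

    vertex : Seed → Vertex
    vertex A = proj₁ (seedVertex A)

    vertex-HasColor : ∀ A → HasColor (vertex A) (inj₁ (index A))
    vertex-HasColor A = class A (inj₁ (proj₂ (seedVertex A))) refl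

    color-vertex-injective : Injective _≡_ _≡_ (color ∘ vertex)
    color-vertex-injective {x = A} {B} e = index-injective (inj₁-injective (code-injective
      (trans (sym (HasColor⇒color≡ (vertex-HasColor A)))
        (trans e (HasColor⇒color≡ (vertex-HasColor B))))))

    seed-disjoint⇒adj : ∀ A (u : Vertex) → Disjoint ∣ A ∣ᵉ ∣ u ∣ᵉ →
                        Graph.Adj (KG m (suc n)) (vertex A) u
    seed-disjoint⇒adj A u A#u = disjoint⇒∩≡⊥ (proj₁ (vertex A)) (proj₁ u)
      (subst (λ l → Disjoint l ∣ u ∣ᵉ) (sym (proj₂ (seedVertex A))) A#u)

    linkVertex : (B : Seed) → ∀ {b} → b ∈ ∣ B ∣ᵉ →
                 Σ[ u ∈ Vertex ] ∣ u ∣ᵉ ≡ link o b ∣ B ∣ᵉ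
    linkVertex B {b} b∈B with ∣ B ∣ᵉ | length-∣∣ᵉ B | seed-Desc B
    ... | x ∷ l | len | d@(x<k ∷ d′) = fromList
      -- Here `k` takes the place of a predecessor of the first member `x` in `link-Desc`.
      (Desc-weaken (ℕ.≤-trans (ℕ.+-monoʳ-≤ o (ℕ.+-monoʳ-≤ k (ℕ.<⇒≤ x<k))) o+2k≤m)
        (link-Desc l (ℕ.<-≤-trans (∈⇒< d b∈B) k≤o) x<k d′))
      (trans (length-link o b (x ∷ l)) len)

    link-disjoint-seed : ∀ (A B : Seed) {b} → b ∉ ∣ A ∣ᵉ → Disjoint ∣ A ∣ᵉ (link o b ∣ B ∣ᵉ)
    link-disjoint-seed A B b∉A (z∈A , z∈) with ∈-link⁻ ∣ B ∣ᵉ z∈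
    ... | inj₁ refl = b∉A z∈A
    ... | inj₂ o≤z  = ℕ.<⇒≱ (∈⇒< (seed-Desc A) z∈A) (ℕ.≤-trans k≤o o≤z)

    -- The tail avoids A and makes i ∷ tail miss all classes: below o the element i is
    -- itself in no member of a class, and from o on the tail is taken outside of [0,k).
    tailFor : ∀ (A : Seed) {i} → k ≤ i →
      ∃[ l ] (Desc i l × length l ≡ n × Disjoint ∣ A ∣ᵉ l × ¬ InSomeClass (i ∷ l))
    tailFor A@(p , ∣p∣≡n) {i} k≤i with i ℕ.<? o
    ... | yes i<o = take n (elements (∁ p)) ,
      Desc-weaken k≤i (Desc-take n (elements-Desc (∁ p))) ,
      trans (length-take n (elements (∁ p))) (ℕ.m≤n⇒m⊓n≡m n≤∣∁p∣) ,
      (λ (z∈A , z∈) → elements-∁-disjoint p (z∈A , ∈-take⁻ n z∈)) ,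
      λ (B , i∷l∈B) → Sum.[ ℕ.≤⇒≯ k≤i , ℕ.<⇒≱ i<o ] (class-range (seed-Desc B) i∷l∈B (here refl))
      where
      n≤∣∁p∣ : n ≤ length (elements (∁ p))
      n≤∣∁p∣ = ℕ.≤-trans (ℕ.m+n≤o⇒m≤o∸n n 2n<k) (ℕ.≤-reflexive (sym
        (trans (length-elements (∁ p)) (trans (∣∁p∣≡n∸∣p∣ p) (cong (k ∸_) ∣p∣≡n)))))
    -- The tail k + n - 1, ..., k fits into the gap [k,o), hence below `i`. Every member of a class
    -- has an element below `k`, which this set lacks.
    ... | no i≮o = applyDownFrom (k +_) n ,
      Desc-applyDownFrom n (ℕ.≤-trans (ℕ.+-monoʳ-≤ k (ℕ.n≤1+n n)) (ℕ.≮⇒≥ i≮o)) ,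
      length-applyDownFrom (k +_) n ,
      (λ (z∈A , z∈) → ℕ.<⇒≱ (∈⇒< (seed-Desc A) z∈A) (∈-applyDownFrom⇒≤ n z∈)) ,
      notInClass
      where
      notInClass : ¬ InSomeClass (i ∷ applyDownFrom (k +_) n)
      notInClass (B , i∷l∈B) with class-meets-ground (seed-nonempty B) (seed-Desc B) i∷l∈B
      ... | _ , here refl , i<k = ℕ.<⇒≱ i<k k≤i
      ... | _ , there z∈  , z<k = ℕ.<⇒≱ z<k (∈-applyDownFrom⇒≤ n z∈)

    -- A set whose maximum is below `k` is a seed and so belongs to its own class.
    top-≥ : ∀ {v : Vertex} {i l} → ∣ v ∣ᵉ ≡ i ∷ l → ¬ InSomeClass ∣ v ∣ᵉ → k ≤ i
    top-≥ {v} {i} e v∉ = ℕ.≮⇒≥ λ i<k →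
      let B , e′ = fromList (i<k ∷ Linked.tail (subst (Desc m) e (elements-Desc (proj₁ v))))
                     (trans (cong length (sym e)) (length-∣∣ᵉ v))
      in v∉ (B , inj₁ (trans e (sym e′)))

    adjacent? : Decidable₂ (Graph.Adj (KG m (suc n)))
    adjacent? u v = Vec.≡-dec Bool._≟_ (proj₁ u ∩ proj₁ v) Subset.⊥

    open BColorings (KG m (suc n)) anySubsetOfSize? adjacent?

    vertex-sees : ∀ A → SeesUsedColors color (vertex A)
    vertex-sees A w cw≢ with coloring w
    -- The neighbor of color `i` is rebuilt with the same maximum and a tail that avoids `A`; `w`
    -- itself may meet `A`.
    ... | x , top i l e w∉ refl =
      let k≤i = top-≥ {w} e w∉
          t , d , len , A#t , i∷t∉ = tailFor A k≤i
          u , eᵤ = fromList (toℕ<n i ∷ d) (cong suc len)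
      in u ,
         seed-disjoint⇒adj A u (subst (Disjoint ∣ A ∣ᵉ) (sym eᵤ)
           λ { (z∈A , here refl) → ℕ.<⇒≱ (∈⇒< (seed-Desc A) z∈A) k≤i
             ; (z∈A , there z∈t) → A#t (z∈A , z∈t) }) ,
         HasColor⇒color≡ (top i t eᵤ (subst (λ l → ¬ InSomeClass l) (sym eᵤ) i∷t∉) refl)
    ... | x , class B w∈B refl =
      -- The colors differ, hence so do the seeds, which are of equal size. The link of `B` at `b`
      -- is then the neighbor.
      let b , b∈B , b∉A = ∃∈∉ (proj₁ B) (proj₁ A)
            (ℕ.≤-reflexive (trans (proj₂ A) (sym (proj₂ B))))
            (λ p≡q → cw≢ (trans
              (cong (code ∘ inj₁ ∘ index) (∣∣ᵉ-injective B A (cong elements p≡q)))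
              (sym (HasColor⇒color≡ (vertex-HasColor A)))))
          u , eᵤ = linkVertex B b∈B
      in u ,
         seed-disjoint⇒adj A u (subst (Disjoint ∣ A ∣ᵉ) (sym eᵤ) (link-disjoint-seed A B b∉A)) ,
         HasColor⇒color≡ (class B (inj₂ (lose b∈B eᵤ)) refl)

    bChromaticNumber-≥ : ∀ {T} (A : Fin T → Seed) → Injective _≡_ _≡_ A → 0 < T →
      ∃[ t ] (IsBChromaticNumber (KG m (suc n)) t × T ≤ t × t ≤ m ^ suc n)
    bChromaticNumber-≥ A A-inj 0<T =
      let s , T≤s , b = bColoring-≥ _ color color-proper (vertex ∘ A)
                          (A-inj ∘ color-vertex-injective) (vertex-sees ∘ A)
          t , χ , s≤t , t≤N = bChromaticNumber index-injective (ℕ.<-≤-trans 0<T T≤s) b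
      in t , χ , ℕ.≤-trans T≤s s≤t , t≤N

-- A large family of seeds

-- Choosing one element from each of the blocks [j q, (j+1) q) gives q ^ n seeds.
transversal : ∀ {q n} → Vec (Fin q) n → List ℕ
transversal                 []       = []
transversal {q} {suc n} (x ∷ xs) = n * q + toℕ x ∷ transversal xs

transversal-Desc : ∀ {q n} (xs : Vec (Fin q) n) → Desc (n * q) (transversal xs)
transversal-Desc []               = [-]
transversal-Desc {q} {suc n} (x ∷ xs) =
  subst (n * q + toℕ x <_) (ℕ.+-comm (n * q) q) (ℕ.+-monoʳ-< (n * q) (toℕ<n x)) ∷
  Desc-weaken (ℕ.m≤m+n (n * q) (toℕ x)) (transversal-Desc xs)

length-transversal : ∀ {q n} (xs : Vec (Fin q) n) → length (transversal xs) ≡ n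
length-transversal []       = refl
length-transversal (x ∷ xs) = cong suc (length-transversal xs)

transversal-injective : ∀ {q n} (xs ys : Vec (Fin q) n) → transversal xs ≡ transversal ys → xs ≡ ys
transversal-injective []       []       _ = refl
transversal-injective {q} {suc n} (x ∷ xs) (y ∷ ys) e =
  cong₂ _∷_ (toℕ-injective (ℕ.+-cancelˡ-≡ (n * q) _ _ (∷-injectiveˡ e)))
            (transversal-injective xs ys (∷-injectiveʳ e))

transversalSet : ∀ {q n} (xs : Vec (Fin q) n) →
                 Σ[ v ∈ SubsetOfSize (n * q) n ] ∣ v ∣ᵉ ≡ transversal xs
transversalSet xs = fromList (transversal-Desc xs) (length-transversal xs)

digits : ∀ {q n} → Fin (q ^ n) → Vec (Fin q) n
digits {q} {n} i = tabulate (Fin.finToFun {q} {n} i)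

digits-injective : ∀ {q n} → Injective _≡_ _≡_ (digits {q} {n})
digits-injective {q} {n} {i} {j} e = trans (sym (funToFin-finToFin {n} i))
  (trans (funToFin-cong λ x → trans (sym (Vec.lookup∘tabulate _ x))
    (trans (cong (λ xs → lookup xs x) e) (Vec.lookup∘tabulate _ x))) (funToFin-finToFin {n} j))
  where
  funToFin-cong : ∀ {n} {f g : Fin n → Fin q} → f ≗ g → Fin.funToFin f ≡ Fin.funToFin g
  funToFin-cong {zero}  f≗g = refl
  funToFin-cong {suc n} f≗g = cong₂ Fin.combine (f≗g Fin.zero) (funToFin-cong (f≗g ∘ Fin.suc))

sample : ∀ {q n} → Fin (q ^ n) → SubsetOfSize (n * q) n
sample {q} {n} i = proj₁ (transversalSet (digits {q} {n} i))

sample-injective : ∀ {q n} → Injective _≡_ _≡_ (sample {q} {n})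
sample-injective {q} {n} {i} {j} e = digits-injective {q} {n} (transversal-injective _ _
  (trans (sym (proj₂ (transversalSet (digits {q} {n} i))))
    (trans (cong ∣_∣ᵉ e) (proj₂ (transversalSet (digits {q} {n} j))))))

-- Choice of parameters and the final estimate

^-distribʳ-* : ∀ n x y → (x * y) ^ n ≡ x ^ n * y ^ n
^-distribʳ-* zero    x y = refl
^-distribʳ-* (suc n) x y = trans (cong (x * y *_) (^-distribʳ-* n x y))
  (ℕ.[m*n]*[o*p]≡[m*o]*[n*p] x y (x ^ n) (y ^ n))

module _ (n : ℕ) where
  private
    N = suc n

  bChromaticNumber-bounds : ∀ m → 2 * (4 * N) ≤ m →
    ∃[ t ] (IsBChromaticNumber (KG m N) t × m ^ N ≤ (8 * N) ^ N * t × t ≤ m ^ N)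
  bChromaticNumber-bounds m 8N≤m =
    let t , χ , q^N≤t , t≤m^N = Construction.bChromaticNumber-≥ n (N * q) m 2N≤k o+2k≤m
                                  (sample {q} {N}) (sample-injective {q} {N}) (ℕ.m^n>0 q N)
    in t , χ , (begin
      m ^ N                   ≤⟨ ℕ.^-monoˡ-≤ N m≤8Nq ⟩
      (8 * N * q) ^ N         ≡⟨ ^-distribʳ-* N (8 * N) q ⟩
      (8 * N) ^ N * q ^ N     ≤⟨ ℕ.*-monoʳ-≤ ((8 * N) ^ N) q^N≤t ⟩
      (8 * N) ^ N * t         ∎) , t≤m^N
    where
    open ℕ.≤-Reasoning
    -- With k = N * q the construction needs 3k + N elements, at most 4 * N * q and thus at most
    -- `m`. The loss is a constant factor, since m < 4 * N * (q + 1) ≤ 8 * N * q.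
    q = m / (4 * N)

    2≤q : 2 ≤ q
    2≤q = subst (_≤ q) (m*n/n≡m 2 (4 * N)) (/-monoˡ-≤ (4 * N) 8N≤m)

    instance
      q≢0 : NonZero q
      q≢0 = ℕ.>-nonZero (ℕ.<⇒≤ 2≤q)

    2N≤k : n + N ≤ N * q
    2N≤k = begin
      n + N  ≤⟨ ℕ.n≤1+n _ ⟩
      N + N  ≡⟨ double N ⟩
      N * 2  ≤⟨ ℕ.*-monoʳ-≤ N 2≤q ⟩
      N * q  ∎
      where
      double : ∀ x → x + x ≡ x * 2
      double = solve-∀

    o+2k≤m : N * q + N + (N * q + N * q) ≤ m
    o+2k≤m = begin
      N * q + N + (N * q + N * q)
        ≤⟨ ℕ.+-monoˡ-≤ (N * q + N * q) (ℕ.+-monoʳ-≤ (N * q) (ℕ.m≤m*n N q)) ⟩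
      N * q + N * q + (N * q + N * q)
        ≡⟨ quadruple N q ⟩
      q * (4 * N)
        ≤⟨ m/n*n≤m m (4 * N) ⟩
      m ∎
      where
      quadruple : ∀ x y → x * y + x * y + (x * y + x * y) ≡ y * (4 * x)
      quadruple = solve-∀

    m≤8Nq : m ≤ 8 * N * q
    m≤8Nq = begin
      m                                ≡⟨ m≡m%n+[m/n]*n m (4 * N) ⟩
      m ℕ.% (4 * N) + q * (4 * N)      ≤⟨ ℕ.+-monoˡ-≤ _ (ℕ.<⇒≤ (m%n<n m (4 * N))) ⟩
      4 * N + q * (4 * N)              ≤⟨ ℕ.+-monoˡ-≤ _ (ℕ.m≤n*m (4 * N) q) ⟩
      q * (4 * N) + q * (4 * N)        ≡⟨ octuple N q ⟩
      8 * N * q                        ∎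
      where
      octuple : ∀ x y → y * (4 * x) + y * (4 * x) ≡ 8 * x * y
      octuple = solve-∀

fromℤ-mono-≤ : ∀ {a b} → a ≤ b → fromℤ (pos a) ℚ.≤ fromℤ (pos b)
fromℤ-mono-≤ a≤b = ℚ.*≤* (ℤ.*-monoʳ-≤-nonNeg (pos 1) (ℤ.+≤+ a≤b))

-- Cross-multiplying the unnormalised fractions a / (suc d) and b / 1 turns the claim into the
-- hypothesis.
1/-*-≤ : ∀ d {a b} → a ≤ suc d * b → 1/ fromℤ (pos (suc d)) ℚ.* fromℤ (pos a) ℚ.≤ fromℤ (pos b)
1/-*-≤ d {a} {b} a≤ = ℚ.toℚᵘ-cancel-≤ (ℚᵘ.≤-respˡ-≃
  (ℚᵘ.≃-sym (ℚ.toℚᵘ-homo-* (1/ fromℤ (pos (suc d))) (fromℤ (pos a))))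
  (ℚᵘ.*≤* (subst₂ ℤ._≤_ (sym lhs) (sym rhs) (ℤ.+≤+ a≤))))
  where
  lhs : (pos 1 ℤ.* pos a) ℤ.* pos 1 ≡ pos a
  lhs = trans (ℤ.*-identityʳ _) (ℤ.*-identityˡ (pos a))

  rhs : pos b ℤ.* pos (suc d * 1) ≡ pos (suc d * b)
  rhs = trans (sym (ℤ.pos-* b (suc d * 1)))
    (cong pos (trans (cong (b *_) (ℕ.*-identityʳ (suc d))) (ℕ.*-comm b (suc d))))

corollary1 : ∀ (n : ℕ) .{{_ : NonZero n}} → Θ (λ m t → IsBChromaticNumber (KG m n) t) (λ m → m ^ n)
corollary1 n@(suc n-1) =
  -- The added one makes the denominator visibly a successor and costs only a summand `t` in the
  -- lower bound. The constant `1ℚ` comes from the bound m ^ n on the number of vertices.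
  1/ fromℤ (pos (suc ((8 * n) ^ n))) , 1ℚ , 2 * (4 * n) ,
  ℚ.positive⁻¹ _ , ℚ.positive⁻¹ _ , λ m m₀≤m →
    let t , χ , lower , upper = bChromaticNumber-bounds n-1 m m₀≤m in
    t , χ ,
    1/-*-≤ ((8 * n) ^ n) (ℕ.≤-trans lower (ℕ.m≤n+m _ t)) ,
    subst (fromℤ (pos t) ℚ.≤_) (sym (ℚ.*-identityˡ _)) (fromℤ-mono-≤ upper)
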